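{- For every sequent $\Gamma\Rightarrow\Delta$: if $\Gamma\Rightarrow\Delta$ is derivable in $\mathsf{G}_{\mathsf{bMDL}}$, then $\bigwedge\Gamma\to\bigvee\Delta$ is valid in all m-models.
   Context: Formulae are built from a set $\mathsf{Var}$ of propositional variables and $\bot$ using the classical connectives $\neg,\land,\lor,\to$, a unary modality $\Box$ and a binary modality $\mathcal{O}(\cdot/\cdot)$. The empty conjunction is $\top:=\bot\to\bot$, the empty disjunction is $\bot$. Semantics. For $R\subseteq W\times W$ and $w\in W$ let $R[w]=\{v\in W\mid wRv\}$; $X^c$ is the complement of $X$ in $W$; $\mathcal{P}$ denotes power set. An m-frame is a triple $(W,R,\eta)$ with $W$ a non-empty set, $R\subseteq W\times W$ and $\eta:W\to\mathcal{P}(\mathcal{P}(W)\times\mathcal{P}(W))$ such that for all $w\in W$ and $X,Y,Z\subseteq W$: (i) $R$ is transitive and reflexive; (ii) if $(X,Y)\in\eta(w)$ then $X\subseteq R[w]$ and $Y\subseteq R[w]$; (iii) if $(X,Z)\in\eta(w)$ and $X\subseteq Y\subseteq R[w]$ then $(Y,Z)\in\eta(w)$; (iv) $(\emptyset,X)\notin\eta(w)$; (v) if $(X,Y)\in\eta(w)$ then $(X^c\cap R[w],Y)\notin\eta(w)$. An m-model is an m-frame with a valuation $\sigma:W\to\mathcal{P}(\mathsf{Var})$. Truth sets are defined by $[\![p]\!]=\{w\in W\mid p\in\sigma(w)\}$, the usual clauses for Boolean connectives, $[\![\Box\varphi]\!]=\{w\in W\mid R[w]\subseteq[\![\varphi]\!]\}$,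 and $[\![\mathcal{O}(\varphi/\psi)]\!]=\{w\in W\mid([\![\varphi]\!]\cap R[w],[\![\psi]\!]\cap R[w])\in\eta(w)\}$. A formula is valid in an m-model if its truth set is $W$. Calculus. A sequent $\Gamma\Rightarrow\Delta$ is a pair of finite multisets of formulae. $\Gamma^{\Box}$ denotes the multiset obtained from $\Gamma$ by deleting every occurrence of a formula not of the form $\Box\varphi$. The calculus $\mathsf{G}_{\mathsf{bMDL}}$ has initial sequents $\Gamma,\varphi\Rightarrow\varphi,\Delta$, the zero-premiss rule $\Gamma,\bot\Rightarrow\Delta$, and the following rules. Propositional rules (principal formula copied into the premisses): ($\neg L$) from $\Gamma,\neg\varphi\Rightarrow\varphi,\Delta$ infer $\Gamma,\neg\varphi\Rightarrow\Delta$; ($\neg R$) from $\Gamma,\varphi\Rightarrow\neg\varphi,\Delta$ infer $\Gamma\Rightarrow\neg\varphi,\Delta$; ($\land L$) from $\Gamma,\varphi\land\psi,\varphi,\psi\Rightarrow\Delta$ infer $\Gamma,\varphi\land\psi\Rightarrow\Delta$; ($\land R$) from $\Gamma\Rightarrow\varphi\land\psi,\varphi,\Delta$ and $\Gamma\Rightarrow\varphi\land\psi,\psi,\Delta$ infer $\Gamma\Rightarrow\varphi\land\psi,\Delta$; ($\lor L$) from $\Gamma,\varphi\lor\psi,\varphi\Rightarrow\Delta$ and $\Gamma,\varphi\lor\psi,\psi\Rightarrow\Delta$ infer $\Gamma,\varphi\lor\psi\Rightarrow\Delta$; ($\lor R$) from $\Gamma\Rightarrow\varphi\lor\psi,\varphi,\psi,\Delta$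 infer $\Gamma\Rightarrow\varphi\lor\psi,\Delta$; ($\to L$) from $\Gamma,\varphi\to\psi\Rightarrow\varphi,\Delta$ and $\Gamma,\varphi\to\psi,\psi\Rightarrow\Delta$ infer $\Gamma,\varphi\to\psi\Rightarrow\Delta$; ($\to R$) from $\Gamma,\varphi\Rightarrow\varphi\to\psi,\psi,\Delta$ infer $\Gamma\Rightarrow\varphi\to\psi,\Delta$. Modal rules: ($\mathsf{4}$) from $\Gamma^{\Box}\Rightarrow\varphi$ infer $\Gamma\Rightarrow\Box\varphi,\Delta$; ($\mathsf{T}$) from $\Gamma,\Box\varphi,\varphi\Rightarrow\Delta$ infer $\Gamma,\Box\varphi\Rightarrow\Delta$; ($\mathsf{Mon}$) from $\Gamma^{\Box},\varphi\Rightarrow\theta$, $\Gamma^{\Box},\psi\Rightarrow\chi$ and $\Gamma^{\Box},\chi\Rightarrow\psi$ infer $\Gamma,\mathcal{O}(\varphi/\psi)\Rightarrow\mathcal{O}(\theta/\chi),\Delta$; ($\mathsf{D}_1$) from $\Gamma^{\Box},\varphi\Rightarrow$ infer $\Gamma,\mathcal{O}(\varphi/\psi)\Rightarrow\Delta$; ($\mathsf{D}_2$) from $\Gamma^{\Box},\varphi,\theta\Rightarrow$, $\Gamma^{\Box},\psi\Rightarrow\chi$ and $\Gamma^{\Box},\chi\Rightarrow\psi$ infer $\Gamma,\mathcal{O}(\varphi/\psi),\mathcal{O}(\theta/\chi)\Rightarrow\Delta$. -}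

module Defs where

open import Data.List.Base using (List; []; _∷_; filter)
open import Data.List.Relation.Binary.Permutation.Propositional using (_↭_)
open import Data.Product.Base using (_×_; _,_)
open import Level using (Level; _⊔_) renaming (suc to lsuc)
open import Relation.Binary.Core using (Rel)
open import Relation.Binary.Definitions using (Reflexive; Transitive)
open import Relation.Nullary.Decidable.Core using (yes; no)
open import Relation.Unary using
  (Pred; Decidable; Universal; _∈_; _∉_; _⊆_; _≐_; _∩_; _∪_; ∁)
  renaming (_⇒_ to _⇒ᵖ_)
open import Relation.Unary.Polymorphic using (∅)

private
  variable
    v : Level
    Var : Set v

------------------------------------------------------------------------
-- Formulae

infix  9 ¬_ □_
infixr 8 _∧_
infixr 7 _∨_
infixr 6 _⊃_

data Formula (Var : Set v) : Set v where
  var     : Var → Formula Var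
  ⊥       : Formula Var
  ¬_      : Formula Var → Formula Var
  _∧_     : Formula Var → Formula Var → Formula Var
  _∨_     : Formula Var → Formula Var → Formula Var
  _⊃_     : Formula Var → Formula Var → Formula Var
  □_      : Formula Var → Formula Var
  𝒪[_/_]  : Formula Var → Formula Var → Formula Var

⊤ : Formula Var
⊤ = ⊥ ⊃ ⊥

⋀ : List (Formula Var) → Formula Var
⋀ []          = ⊤
⋀ (φ ∷ [])    = φ
⋀ (φ ∷ ψ ∷ Γ) = φ ∧ ⋀ (ψ ∷ Γ)

⋁ : List (Formula Var) → Formula Var
⋁ []          = ⊥
⋁ (φ ∷ [])    = φ
⋁ (φ ∷ ψ ∷ Δ) = φ ∨ ⋁ (ψ ∷ Δ)

------------------------------------------------------------------------
-- Semantics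

-- Subsets are predicates, so that equality of sets is _≐_ rather than
-- _≡_. The field η-resp-≐ says that η w is a set of pairs of sets, i.e.
-- that membership in it does not depend on the predicates chosen to
-- represent the two components.

record MFrame (ℓ : Level) : Set (lsuc ℓ) where
  field
    W         : Set ℓ
    inhabited : W
    R         : Rel W ℓ
    η         : W → Pred (Pred W ℓ × Pred W ℓ) ℓ

    η-resp-≐  : ∀ {w X X′ Y Y′} → X ≐ X′ → Y ≐ Y′ →
                (X , Y) ∈ η w → (X′ , Y′) ∈ η w

    R-refl    : Reflexive R
    R-trans   : Transitive R
    η-local   : ∀ {w X Y} → (X , Y) ∈ η w → X ⊆ R w × Y ⊆ R w
    η-mono    : ∀ {w X Y Z} → (X , Z) ∈ η w → X ⊆ Y → Y ⊆ R w →
                (Y , Z) ∈ η w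
    η-∅       : ∀ {w X} → (∅ , X) ∉ η w
    η-∁       : ∀ {w X Y} → (X , Y) ∈ η w → (∁ X ∩ R w , Y) ∉ η w

record MModel (Var : Set v) (ℓ : Level) : Set (v ⊔ lsuc ℓ) where
  field
    frame : MFrame ℓ

  open MFrame frame public

  field
    σ : W → Pred Var ℓ

  ⟦_⟧ : Formula Var → Pred W ℓ
  ⟦ var p ⟧      = λ w → p ∈ σ w
  ⟦ ⊥ ⟧          = ∅
  ⟦ ¬ φ ⟧        = ∁ ⟦ φ ⟧
  ⟦ φ ∧ ψ ⟧      = ⟦ φ ⟧ ∩ ⟦ ψ ⟧
  ⟦ φ ∨ ψ ⟧      = ⟦ φ ⟧ ∪ ⟦ ψ ⟧
  ⟦ φ ⊃ ψ ⟧      = ⟦ φ ⟧ ⇒ᵖ ⟦ ψ ⟧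
  ⟦ □ φ ⟧        = λ w → R w ⊆ ⟦ φ ⟧
  ⟦ 𝒪[ φ / ψ ] ⟧ = λ w → (⟦ φ ⟧ ∩ R w , ⟦ ψ ⟧ ∩ R w) ∈ η w

  Valid : Formula Var → Set ℓ
  Valid φ = Universal ⟦ φ ⟧

------------------------------------------------------------------------
-- The calculus G_bMDL

data IsBox {Var : Set v} : Pred (Formula Var) v where
  box : ∀ {φ} → IsBox (□ φ)

isBox? : Decidable (IsBox {Var = Var})
isBox? (var _)      = no λ ()
isBox? ⊥            = no λ ()
isBox? (¬ _)        = no λ ()
isBox? (_ ∧ _)      = no λ ()
isBox? (_ ∨ _)      = no λ ()
isBox? (_ ⊃ _)      = no λ ()
isBox? (□ _)        = yes box
isBox? 𝒪[ _ / _ ]   = no λ ()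

infix 10 _^□

_^□ : List (Formula Var) → List (Formula Var)
Γ ^□ = filter isBox? Γ

infix 3 ⊢_⟹_

-- Finite multisets are lists up to _↭_; the constructor exch identifies
-- permuted lists, so that each rule may mention its principal and active
-- formulae at the head of a list.

data ⊢_⟹_ {Var : Set v} : List (Formula Var) → List (Formula Var) → Set v where
  exch : ∀ {Γ Γ′ Δ Δ′} → Γ ↭ Γ′ → Δ ↭ Δ′ → ⊢ Γ ⟹ Δ → ⊢ Γ′ ⟹ Δ′

  init : ∀ {Γ Δ φ} → ⊢ φ ∷ Γ ⟹ φ ∷ Δ
  ⊥L   : ∀ {Γ Δ} → ⊢ ⊥ ∷ Γ ⟹ Δ

  ¬L   : ∀ {Γ Δ φ} →
         ⊢ ¬ φ ∷ Γ ⟹ φ ∷ Δ →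
         ⊢ ¬ φ ∷ Γ ⟹ Δ
  ¬R   : ∀ {Γ Δ φ} →
         ⊢ φ ∷ Γ ⟹ ¬ φ ∷ Δ →
         ⊢ Γ ⟹ ¬ φ ∷ Δ
  ∧L   : ∀ {Γ Δ φ ψ} →
         ⊢ φ ∧ ψ ∷ φ ∷ ψ ∷ Γ ⟹ Δ →
         ⊢ φ ∧ ψ ∷ Γ ⟹ Δ
  ∧R   : ∀ {Γ Δ φ ψ} →
         ⊢ Γ ⟹ φ ∧ ψ ∷ φ ∷ Δ →
         ⊢ Γ ⟹ φ ∧ ψ ∷ ψ ∷ Δ →
         ⊢ Γ ⟹ φ ∧ ψ ∷ Δ
  ∨L   : ∀ {Γ Δ φ ψ} →
         ⊢ φ ∨ ψ ∷ φ ∷ Γ ⟹ Δ →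
         ⊢ φ ∨ ψ ∷ ψ ∷ Γ ⟹ Δ →
         ⊢ φ ∨ ψ ∷ Γ ⟹ Δ
  ∨R   : ∀ {Γ Δ φ ψ} →
         ⊢ Γ ⟹ φ ∨ ψ ∷ φ ∷ ψ ∷ Δ →
         ⊢ Γ ⟹ φ ∨ ψ ∷ Δ
  ⊃L   : ∀ {Γ Δ φ ψ} →
         ⊢ φ ⊃ ψ ∷ Γ ⟹ φ ∷ Δ →
         ⊢ φ ⊃ ψ ∷ ψ ∷ Γ ⟹ Δ →
         ⊢ φ ⊃ ψ ∷ Γ ⟹ Δ
  ⊃R   : ∀ {Γ Δ φ ψ} →
         ⊢ φ ∷ Γ ⟹ φ ⊃ ψ ∷ ψ ∷ Δ →
         ⊢ Γ ⟹ φ ⊃ ψ ∷ Δ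

  4R   : ∀ {Γ Δ φ} →
         ⊢ Γ ^□ ⟹ φ ∷ [] →
         ⊢ Γ ⟹ □ φ ∷ Δ
  TL   : ∀ {Γ Δ φ} →
         ⊢ □ φ ∷ φ ∷ Γ ⟹ Δ →
         ⊢ □ φ ∷ Γ ⟹ Δ
  Mon  : ∀ {Γ Δ φ ψ θ χ} →
         ⊢ φ ∷ Γ ^□ ⟹ θ ∷ [] →
         ⊢ ψ ∷ Γ ^□ ⟹ χ ∷ [] →
         ⊢ χ ∷ Γ ^□ ⟹ ψ ∷ [] →
         ⊢ 𝒪[ φ / ψ ] ∷ Γ ⟹ 𝒪[ θ / χ ] ∷ Δ
  D₁   : ∀ {Γ Δ φ ψ} →
         ⊢ φ ∷ Γ ^□ ⟹ [] →
         ⊢ 𝒪[ φ / ψ ] ∷ Γ ⟹ Δ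
  D₂   : ∀ {Γ Δ φ ψ θ χ} →
         ⊢ φ ∷ θ ∷ Γ ^□ ⟹ [] →
         ⊢ ψ ∷ Γ ^□ ⟹ χ ∷ [] →
         ⊢ χ ∷ Γ ^□ ⟹ ψ ∷ [] →
         ⊢ 𝒪[ φ / ψ ] ∷ 𝒪[ θ / χ ] ∷ Γ ⟹ Δ

{-# OPTIONS --safe #-}
module Submission where

open import Axiom.ExcludedMiddle using (ExcludedMiddle)
open import Data.Empty using (⊥-elim)
open import Data.List.Base using (List; []; _∷_)
open import Data.List.Relation.Binary.Permutation.Propositional using (↭-sym)
open import Data.List.Relation.Binary.Permutation.Propositional.Properties
  using (All-resp-↭; Any-resp-↭)
open import Data.List.Relation.Unary.All using (All; []; _∷_)
open import Data.List.Relation.Unary.Any using (Any; here; there)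
open import Data.Product.Base using (_,_; proj₂)
open import Data.Sum.Base using (inj₁; inj₂)
open import Function.Base using (_∘_)
open import Level using (lift; lower)
open import Relation.Nullary.Decidable.Core using (yes; no)
open import Relation.Unary using (Pred; _≐_; _∈_; _∉_)
open import Defs

-- The propositional rules are classical reasoning at one world, and `TL` is reflexivity. The
-- premisses of the other modal rules are read at an arbitrary successor `u` of `w`, where the boxed
-- formulae of the antecedent still hold by transitivity. They thus state inclusions, equalities or
-- disjointness of truth sets cut down to `R w`, which is all that `η w` sees; `η-mono`, `η-∅` and
-- `η-∁` then justify `Mon`, `D₁` and `D₂`.

module _ {v ℓ} {Var : Set v} (M : MModel Var ℓ) where
  open MModel M

  infix 4 _⊩∀_ _⊩∃_

  _⊩∀_ : W → List (Formula Var) → Set _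
  w ⊩∀ Γ = All (λ φ → w ∈ ⟦ φ ⟧) Γ

  _⊩∃_ : W → List (Formula Var) → Set _
  w ⊩∃ Δ = Any (λ φ → w ∈ ⟦ φ ⟧) Δ

  ⋀-elim : ∀ {w} Γ → w ∈ ⟦ ⋀ Γ ⟧ → w ⊩∀ Γ
  ⋀-elim []          _        = []
  ⋀-elim (_ ∷ [])    wφ       = wφ ∷ []
  ⋀-elim (_ ∷ ψ ∷ Γ) (wφ , t) = wφ ∷ ⋀-elim (ψ ∷ Γ) t

  ⋁-intro : ∀ {w} Δ → w ⊩∃ Δ → w ∈ ⟦ ⋁ Δ ⟧
  ⋁-intro (_ ∷ [])    (here wφ) = wφ
  ⋁-intro (_ ∷ ψ ∷ Δ) (here wφ) = inj₁ wφ
  ⋁-intro (_ ∷ ψ ∷ Δ) (there t) = inj₂ (⋁-intro (ψ ∷ Δ) t)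

  ⊩∃-singleton : ∀ {w φ} → w ⊩∃ φ ∷ [] → w ∈ ⟦ φ ⟧
  ⊩∃-singleton (here wφ) = wφ

  -- A successor of `u` is a successor of `w`, so boxes survive the step. The split on the head
  -- formula lets the filter compute.
  ^□-persistent : ∀ {w u} Γ → R w u → w ⊩∀ Γ → u ⊩∀ Γ ^□
  ^□-persistent []               r []       = []
  ^□-persistent (var _ ∷ Γ)      r (_ ∷ γ)  = ^□-persistent Γ r γ
  ^□-persistent (⊥ ∷ Γ)          r (_ ∷ γ)  = ^□-persistent Γ r γ
  ^□-persistent ((¬ _) ∷ Γ)      r (_ ∷ γ)  = ^□-persistent Γ r γ
  ^□-persistent ((_ ∧ _) ∷ Γ)    r (_ ∷ γ)  = ^□-persistent Γ r γ
  ^□-persistent ((_ ∨ _) ∷ Γ)    r (_ ∷ γ)  = ^□-persistent Γ r γ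
  ^□-persistent ((_ ⊃ _) ∷ Γ)    r (_ ∷ γ)  = ^□-persistent Γ r γ
  ^□-persistent ((□ _) ∷ Γ)      r (w□ ∷ γ) =
    (λ s → w□ (R-trans r s)) ∷ ^□-persistent Γ r γ
  ^□-persistent (𝒪[ _ / _ ] ∷ Γ) r (_ ∷ γ)  = ^□-persistent Γ r γ

  ≐-refl : ∀ {X : Pred W ℓ} → X ≐ X
  ≐-refl = (λ x → x) , (λ x → x)

  -- The first component of `η w` is upward closed, but the second may only be exchanged for an
  -- equal set; hence one implication for the obligation and two for the condition.
  𝒪-mono : ∀ {w φ ψ θ χ} →
           (∀ {u} → R w u → u ∈ ⟦ φ ⟧ → u ∈ ⟦ θ ⟧) →
           (∀ {u} → R w u → u ∈ ⟦ ψ ⟧ → u ∈ ⟦ χ ⟧) →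
           (∀ {u} → R w u → u ∈ ⟦ χ ⟧ → u ∈ ⟦ ψ ⟧) →
           w ∈ ⟦ 𝒪[ φ / ψ ] ⟧ → w ∈ ⟦ 𝒪[ θ / χ ] ⟧
  𝒪-mono φ⇒θ ψ⇒χ χ⇒ψ o =
    η-resp-≐ ≐-refl
      ((λ (uψ , r) → ψ⇒χ r uψ , r) , (λ (uχ , r) → χ⇒ψ r uχ , r))
      (η-mono o (λ (uφ , r) → φ⇒θ r uφ , r) proj₂)

  𝒪-consistent : ∀ {w φ ψ} → (∀ {u} → R w u → u ∉ ⟦ φ ⟧) →
                 w ∉ ⟦ 𝒪[ φ / ψ ] ⟧
  𝒪-consistent ¬φ o =
    η-∅ (η-resp-≐ ((λ (uφ , r) → lift (¬φ r uφ)) , ⊥-elim ∘ lower) ≐-refl o)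

  -- Within `R w`, the truth set of `φ` lies in the complement of that of `θ`, so the first
  -- obligation would make this complement obligatory under `χ`, against `η-∁`.
  𝒪-compatible : ∀ {w φ ψ θ χ} →
                 (∀ {u} → R w u → u ∈ ⟦ φ ⟧ → u ∉ ⟦ θ ⟧) →
                 (∀ {u} → R w u → u ∈ ⟦ ψ ⟧ → u ∈ ⟦ χ ⟧) →
                 (∀ {u} → R w u → u ∈ ⟦ χ ⟧ → u ∈ ⟦ ψ ⟧) →
                 w ∈ ⟦ 𝒪[ φ / ψ ] ⟧ → w ∉ ⟦ 𝒪[ θ / χ ] ⟧
  𝒪-compatible {φ = φ} {ψ} {θ} {χ} φ⇒¬θ ψ⇒χ χ⇒ψ o o′ =
    -- The inner `𝒪-mono` keeps `φ` and only trades the condition `ψ` for `χ`; the outer `η-mono`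
    -- enlarges `φ` to the complement.
    η-∁ o′ (η-mono (𝒪-mono {φ = φ} {ψ} {φ} {χ} (λ _ uφ → uφ) ψ⇒χ χ⇒ψ o)
                   (λ (uφ , r) → (λ (uθ , _) → φ⇒¬θ r uφ uθ) , r) proj₂)

  module _ (em : ExcludedMiddle ℓ) where

    -- The world is quantified after the derivation, so that the induction hypothesis applies at
    -- successors. `All` and `Any` transport along permutations, which settles `exch`.
    sound : ∀ {Γ Δ} → ⊢ Γ ⟹ Δ → ∀ {w} → w ⊩∀ Γ → w ⊩∃ Δ

    sound-^□ : ∀ {Γ φ θ w u} → ⊢ φ ∷ Γ ^□ ⟹ θ ∷ [] → w ⊩∀ Γ →
               R w u → u ∈ ⟦ φ ⟧ → u ∈ ⟦ θ ⟧
    sound-^□ {Γ} d γ r uφ = ⊩∃-singleton (sound d (uφ ∷ ^□-persistent Γ r γ))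

    sound (exch p q d) γ = Any-resp-↭ q (sound d (All-resp-↭ (↭-sym p) γ))
    sound init (wφ ∷ _) = here wφ
    sound ⊥L (() ∷ _)
    sound (¬L d) (w¬φ ∷ γ) with sound d (w¬φ ∷ γ)
    ... | here wφ = ⊥-elim (w¬φ wφ)
    ... | there δ = δ
    -- The premiss is usable only if `φ` holds at `w`; deciding this is where classical logic
    -- enters, here and in `⊃R`.
    sound (¬R {φ = φ} d) {w} γ with em {⟦ φ ⟧ w}
    ... | yes wφ = sound d (wφ ∷ γ)
    ... | no w¬φ = here w¬φ
    sound (∧L d) ((wφ , wψ) ∷ γ) = sound d ((wφ , wψ) ∷ wφ ∷ wψ ∷ γ)
    sound (∧R d e) γ with sound d γ | sound e γ
    ... | here wφψ         | _                = here wφψ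
    ... | there _          | here wφψ         = here wφψ
    ... | there (here wφ)  | there (here wψ)  = here (wφ , wψ)
    ... | there (there δ)  | there _          = there δ
    ... | there (here _)   | there (there δ)  = there δ
    sound (∨L d e) (inj₁ wφ ∷ γ) = sound d (inj₁ wφ ∷ wφ ∷ γ)
    sound (∨L d e) (inj₂ wψ ∷ γ) = sound e (inj₂ wψ ∷ wψ ∷ γ)
    sound (∨R d) γ with sound d γ
    ... | here wφψ                = here wφψ
    ... | there (here wφ)         = here (inj₁ wφ)
    ... | there (there (here wψ)) = here (inj₂ wψ)
    ... | there (there (there δ)) = there δ
    sound (⊃L d e) (wφψ ∷ γ) with sound d (wφψ ∷ γ)
    ... | here wφ = sound e (wφψ ∷ wφψ wφ ∷ γ)
    ... | there δ = δ
    sound (⊃R {φ = φ} d) {w} γ with em {⟦ φ ⟧ w}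
    ... | no w¬φ = here (⊥-elim ∘ w¬φ)
    ... | yes wφ with sound d (wφ ∷ γ)
    ...   | here wφψ        = here wφψ
    ...   | there (here wψ) = here (λ _ → wψ)
    ...   | there (there δ) = there δ
    sound (4R {Γ} d) γ =
      here λ r → ⊩∃-singleton (sound d (^□-persistent Γ r γ))
    sound (TL d) (w□φ ∷ γ) = sound d (w□φ ∷ w□φ R-refl ∷ γ)
    sound (Mon {φ = φ} {ψ} {θ} {χ} d e f) (o ∷ γ) =
      here (𝒪-mono {φ = φ} {ψ} {θ} {χ}
              (sound-^□ d γ) (sound-^□ e γ) (sound-^□ f γ) o)
    sound (D₁ {Γ} {φ = φ} {ψ} d) (o ∷ γ) =
      ⊥-elim (𝒪-consistent {φ = φ} {ψ} φ-unsat o)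
      where
      φ-unsat : ∀ {u} → R _ u → u ∉ ⟦ φ ⟧
      -- No formula of an empty succedent can hold at `u`.
      φ-unsat r uφ with () ← sound d (uφ ∷ ^□-persistent Γ r γ)
    sound (D₂ {Γ} {φ = φ} {ψ} {θ} {χ} d e f) (o ∷ o′ ∷ γ) =
      ⊥-elim (𝒪-compatible {φ = φ} {ψ} {θ} {χ}
                φθ-unsat (sound-^□ e γ) (sound-^□ f γ) o o′)
      where
      φθ-unsat : ∀ {u} → R _ u → u ∈ ⟦ φ ⟧ → u ∉ ⟦ θ ⟧
      φθ-unsat r uφ uθ with () ← sound d (uφ ∷ uθ ∷ ^□-persistent Γ r γ)

corollary2 : ∀ {v ℓ} → ExcludedMiddle ℓ → {Var : Set v} → (Γ Δ : List (Formula Var)) → ⊢ Γ ⟹ Δ → (M : MModel Var ℓ) → MModel.Valid M (⋀ Γ ⊃ ⋁ Δ)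
corollary2 em Γ Δ d M _ = ⋁-intro M Δ ∘ sound M em d ∘ ⋀-elim M Γ
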